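{- Let $P,Q$ be closed wire calculus terms of sort $(k,l)$, $R$ a closed term of sort $(m,n)$, $S$ a closed term of sort $(l,l')$ and $T$ a closed term of sort $(k',k)$, and suppose $P\sim Q$. Then: (i) $P\mathrel{;}S\sim Q\mathrel{;}S$ and $T\mathrel{;}P\sim T\mathrel{;}Q$; (ii) $P\otimes R\sim Q\otimes R$ and $R\otimes P\sim R\otimes Q$; (iii) for prefix strings $u,v$ such that the prefix terms are well-sorted closed terms, $\frac{u}{v}.P\sim\frac{u}{v}.Q$; (iv) $P+R\sim Q+R$ and $R+P\sim R+Q$ (whenever these are well-sorted, i.e. $R$ has sort $(k,l)$).
   Context: Wire calculus. Fix a set $\Sigma$ of signals and a symbol $\iota\notin\Sigma$ ("no signal"); $L=\Sigma\cup\{\iota\}$. Prefix strings are words over the atoms: signal variables $x$, binders $\lambda x$, $\iota$, and constants $\sigma\in\Sigma$. Terms: $P::= Y \mid P\mathrel{;}P\mid P\otimes P\mid \frac{u}{v}.P\mid P+P\mid \mu Y{:}\tau.P$, with $Y$ process variables, $u,v$ prefix strings, $\tau$ a sort $(k,l)$, $k,l\ge0$. In $\frac{u}{v}.P$ the variables $x$ with $\lambda x$ occurring in $uv$ are bound in $P$ (the set $bd$); other variables occurring in $uv$ are free ($fr$). Sorting (context $\Gamma$ of sorted process variables and signal variables): $Y$ has its declared sort; if $P:(k,n)$, $R:(n,l)$ then $P\mathrel{;}R:(k,l)$; if $P:(k,l)$, $Q:(m,n)$ then $P\otimes Q:(k+m,l+n)$; if $P:\tau$ under $\Gamma,Y{:}\tau'$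 then $\mu Y{:}\tau'.P:\tau$; if $|u|=k$, $|v|=l$, $fr\cap bd=\varnothing$, $fr\subseteq\Gamma$ and $P:(k,l)$ under $\Gamma\cup bd$, then $\frac{u}{v}.P:(k,l)$; if $P,Q:\tau$ then $P+Q:\tau$. Only closed terms (sorted in the empty context) are considered; terms are taken up to renaming of bound variables, with no other structural congruence. $\otimes$ binds tighter than $;$. Semantics: transitions $P\xrightarrow[\vec b]{\vec a}Q$ with $\vec a,\vec b\in L^*$ (upper label $\vec a$ of length $k$, lower $\vec b$ of length $l$ for $P:(k,l)$), $\vec\iota$ denoting words of $\iota$'s, generated by the rules: (Refl) $P\xrightarrow[\vec\iota]{\vec\iota}P$; ($\iota$L) from $P\xrightarrow[\vec\iota]{\vec\iota}R$ and $R\xrightarrow[\vec b]{\vec a}Q$ infer $P\xrightarrow[\vec b]{\vec a}Q$; ($\iota$R) from $P\xrightarrow[\vec b]{\vec a}R$ and $R\xrightarrow[\vec\iota]{\vec\iota}Q$ infer $P\xrightarrow[\vec b]{\vec a}Q$; (Cut) from $P\xrightarrow[\vec c]{\vec a}Q$, $R\xrightarrow[\vec b]{\vec c}S$ infer $P\mathrel{;}R\xrightarrow[\vec b]{\vec a}Q\mathrel{;}S$; (Ten) from $P\xrightarrow[\vec b]{\vec a}Q$, $R\xrightarrow[\vec d]{\vec c}S$ infer $P\otimes R\xrightarrow[\vec b\vec d]{\vec a\vec c}Q\otimes S$; (Pref) for every map $\sigma:bd\to L$, $\frac{u}{v}.P\xrightarrow[v|_\sigma]{u|_\sigma}P|_\sigma$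 where $u|_\sigma$ replaces each $\lambda x$ by $\sigma(x)$ and $P|_\sigma$ substitutes $\sigma(x)$ for $x$; (Rec) from $P[\mu Y.P/Y]\xrightarrow[\vec b]{\vec a}Q$ infer $\mu Y.P\xrightarrow[\vec b]{\vec a}Q$; ($+\iota$) from $P\xrightarrow[\vec\iota]{\vec\iota}Q$, $R\xrightarrow[\vec\iota]{\vec\iota}S$ infer $P+R\xrightarrow[\vec\iota]{\vec\iota}Q+S$; ($+$L) from $P\xrightarrow[\vec b]{\vec a}Q$ with $\vec a\vec b$ not consisting only of $\iota$'s infer $P+R\xrightarrow[\vec b]{\vec a}Q$, and symmetrically ($+$R). Bisimilarity: for closed terms $P,Q$ of the same sort, $P\sim Q$ iff there is a relation $S$ on terms containing $(P,Q)$ such that whenever $(P',Q')\in S$ and $P'\xrightarrow[\vec b]{\vec a}P''$ there is $Q''$ with $Q'\xrightarrow[\vec b]{\vec a}Q''$ and $(P'',Q'')\in S$, and symmetrically with the roles of the two sides exchanged. -}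

module Defs where

open import Data.Nat using (ℕ; zero; suc; _+_; _∸_; _⊔_; _≤_; _<_; _<?_; pred)
open import Data.Nat.Properties using (<-cmp)
open import Data.Fin using (Fin; toℕ; fromℕ<)
open import Data.List using (List; []; _∷_; _++_; length; map; replicate)
open import Data.List.Relation.Unary.All using (All)
open import Data.List.Relation.Binary.Pointwise using (Pointwise)
open import Data.Product using (_×_; _,_; ∃-syntax)
open import Data.Unit using (⊤)
open import Function using (flip)
open import Relation.Binary using (tri<; tri≈; tri>)
open import Relation.Binary.PropositionalEquality using (_≡_)
open import Relation.Nullary using (¬_; yes; no)

private variable
  Sig : Set

data L (Sig : Set) : Set where
  ι   : L Sig
  sig : Sig → L Sig

Sort : Set
Sort = ℕ × ℕ

-- Terms up to renaming of bound variables are represented by de Bruijn indices,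
-- separately for process variables and for signal variables.  A prefix u/v binds
-- all the variables λx occurring in uv simultaneously:  ƛ i  is the i-th of them
-- (several occurrences of one λx are several occurrences of the same ƛ i).  In the
-- body, signal index i < #bd (u ++ v) refers to ƛ i, and i ≥ #bd (u ++ v) to
-- index i ∸ #bd (u ++ v) outside.  An occurrence  var i  in u or v itself refers
-- to the scope outside the prefix, so that fr ∩ bd = ∅ holds by construction.
data Atom (Sig : Set) : Set where
  var : ℕ → Atom Sig
  ƛ   : ℕ → Atom Sig
  lit : L Sig → Atom Sig

infixl 8 _⊗_
infixl 7 _⨾_
infixl 6 _⊕_

data Term (Sig : Set) : Set where
  pvar : ℕ → Term Sig
  _⨾_  : Term Sig → Term Sig → Term Sig
  _⊗_  : Term Sig → Term Sig → Term Sig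
  pre  : (u v : List (Atom Sig)) → Term Sig → Term Sig
  _⊕_  : Term Sig → Term Sig → Term Sig
  μ    : Sort → Term Sig → Term Sig

#bd : List (Atom Sig) → ℕ
#bd []          = 0
#bd (ƛ i ∷ w)   = suc i ⊔ #bd w
#bd (var _ ∷ w) = #bd w
#bd (lit _ ∷ w) = #bd w

-- The binders of w are numbered in order of first occurrence, continuing from b
-- binders already met.  For  Numbered 0 w  the set bd is exactly {ƛ i | i < #bd w},
-- and α-equivalent prefixes have a single representation.
Numbered : ℕ → List (Atom Sig) → Set
Numbered b []          = ⊤
Numbered b (ƛ i ∷ w)   = i ≤ b × Numbered (b ⊔ suc i) w
Numbered b (var _ ∷ w) = Numbered b w
Numbered b (lit _ ∷ w) = Numbered b w

data FreeBelow {Sig : Set} (n : ℕ) : Atom Sig → Set where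
  var : ∀ {i} → i < n → FreeBelow n (var i)
  ƛ   : ∀ {i} → FreeBelow n (ƛ i)
  lit : ∀ {c} → FreeBelow n (lit c)

data _∋_∶_ : List Sort → ℕ → Sort → Set where
  here  : ∀ {Γ τ} → (τ ∷ Γ) ∋ zero ∶ τ
  there : ∀ {Γ τ τ′ Y} → Γ ∋ Y ∶ τ → (τ′ ∷ Γ) ∋ suc Y ∶ τ

-- Γ sorts the process variables; n is the number of signal variables in scope.
infix 4 _∣_⊢_∶_
data _∣_⊢_∶_ {Sig : Set} (Γ : List Sort) (n : ℕ) : Term Sig → Sort → Set where
  ⊢pvar : ∀ {Y τ} → Γ ∋ Y ∶ τ → Γ ∣ n ⊢ pvar Y ∶ τ
  ⊢⨾    : ∀ {P R k m l} → Γ ∣ n ⊢ P ∶ (k , m) → Γ ∣ n ⊢ R ∶ (m , l) →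
          Γ ∣ n ⊢ P ⨾ R ∶ (k , l)
  ⊢⊗    : ∀ {P Q k l k′ l′} → Γ ∣ n ⊢ P ∶ (k , l) → Γ ∣ n ⊢ Q ∶ (k′ , l′) →
          Γ ∣ n ⊢ P ⊗ Q ∶ (k + k′ , l + l′)
  ⊢pre  : ∀ {u v P k l} → length u ≡ k → length v ≡ l →
          Numbered 0 (u ++ v) → All (FreeBelow n) (u ++ v) →
          Γ ∣ #bd (u ++ v) + n ⊢ P ∶ (k , l) →
          Γ ∣ n ⊢ pre u v P ∶ (k , l)
  ⊢⊕    : ∀ {P Q τ} → Γ ∣ n ⊢ P ∶ τ → Γ ∣ n ⊢ Q ∶ τ → Γ ∣ n ⊢ P ⊕ Q ∶ τ
  ⊢μ    : ∀ {P τ τ′} → (τ′ ∷ Γ) ∣ n ⊢ P ∶ τ → Γ ∣ n ⊢ μ τ′ P ∶ τ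

infix 4 ⊢_∶_
⊢_∶_ : Term Sig → Sort → Set
⊢ P ∶ τ = [] ∣ 0 ⊢ P ∶ τ

-- Instantiation by σ of the b signal variables d, …, d + b ∸ 1, where d counts
-- the signal variables bound between the instantiated prefix and this point.
instVar : ∀ {b} → (Fin b → L Sig) → ℕ → ℕ → Atom Sig
instVar {b = b} σ d i with i <? d | i ∸ d <? b
... | yes _ | _     = var i
... | no _  | yes p = lit (σ (fromℕ< p))
... | no _  | no _  = var (i ∸ b)

instAtom : ∀ {b} → (Fin b → L Sig) → ℕ → Atom Sig → Atom Sig
instAtom σ d (var i) = instVar σ d i
instAtom σ d (ƛ i)   = ƛ i
instAtom σ d (lit c) = lit c

inst : ∀ {b} → (Fin b → L Sig) → ℕ → Term Sig → Term Sig
inst σ d (pvar Y)    = pvar Y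
inst σ d (P ⨾ Q)     = inst σ d P ⨾ inst σ d Q
inst σ d (P ⊗ Q)     = inst σ d P ⊗ inst σ d Q
inst σ d (pre u v P) = pre (map (instAtom σ d) u) (map (instAtom σ d) v)
                           (inst σ (#bd (u ++ v) + d) P)
inst σ d (P ⊕ Q)     = inst σ d P ⊕ inst σ d Q
inst σ d (μ τ P)     = μ τ (inst σ d P)

-- P [ N / d ] replaces process variable d by N.  It is only applied to closed N,
-- so N is not shifted when passing under binders.
_[_/_] : Term Sig → Term Sig → ℕ → Term Sig
pvar Y [ N / d ] with <-cmp Y d
... | tri< _ _ _ = pvar Y
... | tri≈ _ _ _ = N
... | tri> _ _ _ = pvar (pred Y)
(P ⨾ Q)   [ N / d ] = (P [ N / d ]) ⨾ (Q [ N / d ])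
(P ⊗ Q)   [ N / d ] = (P [ N / d ]) ⊗ (Q [ N / d ])
pre u v P [ N / d ] = pre u v (P [ N / d ])
(P ⊕ Q)   [ N / d ] = (P [ N / d ]) ⊕ (Q [ N / d ])
μ τ P     [ N / d ] = μ τ (P [ N / suc d ])

-- The word w|σ is the a with  Pointwise (Fill σ) w a;  there is no clause for
-- var, as a closed prefix has no free signal variables.
data Fill {Sig : Set} {b : ℕ} (σ : Fin b → L Sig) : Atom Sig → L Sig → Set where
  ƛ   : ∀ i → Fill σ (ƛ (toℕ i)) (σ i)
  lit : ∀ c → Fill σ (lit c) c

ιs : ℕ → List (L Sig)
ιs n = replicate n ι

-- P —[ a ∣ b ]→ Q  has upper label a and lower label b.
infix 4 _—[_∣_]→_
data _—[_∣_]→_ {Sig : Set} :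
       Term Sig → List (L Sig) → List (L Sig) → Term Sig → Set where
  Refl : ∀ {P k l} → ⊢ P ∶ (k , l) → P —[ ιs k ∣ ιs l ]→ P
  ιL   : ∀ {P R Q a b k l} → P —[ ιs k ∣ ιs l ]→ R → R —[ a ∣ b ]→ Q →
         P —[ a ∣ b ]→ Q
  ιR   : ∀ {P R Q a b k l} → P —[ a ∣ b ]→ R → R —[ ιs k ∣ ιs l ]→ Q →
         P —[ a ∣ b ]→ Q
  Cut  : ∀ {P Q R S a b c} → P —[ a ∣ c ]→ Q → R —[ c ∣ b ]→ S →
         P ⨾ R —[ a ∣ b ]→ Q ⨾ S
  Ten  : ∀ {P Q R S a b c d} → P —[ a ∣ b ]→ Q → R —[ c ∣ d ]→ S →
         P ⊗ R —[ a ++ c ∣ b ++ d ]→ Q ⊗ S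
  Pref : ∀ {u v P a b} (σ : Fin (#bd (u ++ v)) → L Sig) →
         Pointwise (Fill σ) u a → Pointwise (Fill σ) v b →
         pre u v P —[ a ∣ b ]→ inst σ 0 P
  Rec  : ∀ {P Q τ a b} → P [ μ τ P / 0 ] —[ a ∣ b ]→ Q → μ τ P —[ a ∣ b ]→ Q
  +ι   : ∀ {P Q R S k l} → P —[ ιs k ∣ ιs l ]→ Q → R —[ ιs k ∣ ιs l ]→ S →
         P ⊕ R —[ ιs k ∣ ιs l ]→ Q ⊕ S
  +L   : ∀ {P Q R a b} → ¬ All (_≡ ι) (a ++ b) → P —[ a ∣ b ]→ Q →
         P ⊕ R —[ a ∣ b ]→ Q
  +R   : ∀ {P R S a b} → ¬ All (_≡ ι) (a ++ b) → R —[ a ∣ b ]→ S →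
         P ⊕ R —[ a ∣ b ]→ S

Simulation : (Term Sig → Term Sig → Set) → Set
Simulation S = ∀ {P Q P′ a b} → S P Q → P —[ a ∣ b ]→ P′ →
               ∃[ Q′ ] (Q —[ a ∣ b ]→ Q′) × S P′ Q′

infix 4 _∼_
_∼_ : Term Sig → Term Sig → Set₁
_∼_ {Sig} P Q =
  (∃[ τ ] (⊢ P ∶ τ) × (⊢ Q ∶ τ)) ×
  (∃[ S ] S P Q × Simulation {Sig} S × Simulation {Sig} (flip S))

{-# OPTIONS --safe #-}
-- A bisimulation S is closed under all the operators at once: the relation Cong S
-- is again a bisimulation.  No preservation of sorting along transitions is needed
-- (it fails, because μ Y:τ′.P may have a sort other than τ′): a reflexivity step of
-- a compound term is decomposed into reflexivity steps of its components, which S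
-- answers with some ι-transitions, not necessarily reflexive ones.
module Submission where

open import Data.Nat using (ℕ; zero; suc; _+_; _∸_; _≤_; _<?_; z≤n)
open import Data.Nat.Properties using (<-≤-trans; +-monoʳ-≤)
open import Data.Fin using (Fin)
open import Data.List using (List; _∷_; _++_; map)
open import Data.List.Properties using (map-id-local)
open import Data.List.Relation.Unary.All as All using (All)
open import Data.List.Relation.Unary.All.Properties using (++⁻ˡ; ++⁻ʳ)
open import Data.Product using (_×_; _,_; ∃-syntax)
open import Function using (flip)
open import Relation.Binary.PropositionalEquality using (_≡_; refl; sym; cong; cong₂; subst₂)
open import Relation.Nullary using (yes; no; contradiction)
open import Defs

private variable
  Sig : Set

instAtom-FreeBelow : ∀ {b n d} (σ : Fin b → L Sig) {x : Atom Sig} →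
                     n ≤ d → FreeBelow n x → instAtom σ d x ≡ x
instAtom-FreeBelow {b = b} {d = d} σ n≤d (var {i} i<n) with i <? d | i ∸ d <? b
... | yes _  | _ = refl
... | no i≮d | _ = contradiction (<-≤-trans i<n n≤d) i≮d
instAtom-FreeBelow σ n≤d ƛ   = refl
instAtom-FreeBelow σ n≤d lit = refl

map-instAtom-FreeBelow : ∀ {b n d} (σ : Fin b → L Sig) {w : List (Atom Sig)} →
                         n ≤ d → All (FreeBelow n) w → map (instAtom σ d) w ≡ w
map-instAtom-FreeBelow σ n≤d fs = map-id-local (All.map (instAtom-FreeBelow σ n≤d) fs)

-- Instantiation at depth `d` changes only signal variables of index at least `d`, while sorting
-- bounds the free ones by `n`. Passing a prefix raises both bounds by the same number of binders.
inst-⊢ : ∀ {b n d Γ τ} (σ : Fin b → L Sig) {P : Term Sig} →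
         n ≤ d → Γ ∣ n ⊢ P ∶ τ → inst σ d P ≡ P
inst-⊢ σ n≤d (⊢pvar _) = refl
inst-⊢ σ n≤d (⊢⨾ p q)  = cong₂ _⨾_ (inst-⊢ σ n≤d p) (inst-⊢ σ n≤d q)
inst-⊢ σ n≤d (⊢⊗ p q)  = cong₂ _⊗_ (inst-⊢ σ n≤d p) (inst-⊢ σ n≤d q)
inst-⊢ σ n≤d (⊢pre {u} {v} _ _ _ fs p)
  rewrite map-instAtom-FreeBelow σ n≤d (++⁻ˡ u fs)
        | map-instAtom-FreeBelow σ n≤d (++⁻ʳ u fs)
        = cong (pre u v) (inst-⊢ σ (+-monoʳ-≤ (#bd (u ++ v)) n≤d) p)
inst-⊢ σ n≤d (⊢⊕ p q)  = cong₂ _⊕_ (inst-⊢ σ n≤d p) (inst-⊢ σ n≤d q)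
inst-⊢ σ n≤d (⊢μ p)    = cong (μ _) (inst-⊢ σ n≤d p)

inst-closed : ∀ {b τ} (σ : Fin b → L Sig) {P : Term Sig} → ⊢ P ∶ τ → inst σ 0 P ≡ P
inst-closed σ = inst-⊢ σ z≤n

ιs-+ : ∀ k k′ → ιs {Sig} k ++ ιs k′ ≡ ιs (k + k′)
ιs-+ zero    k′ = refl
ιs-+ (suc k) k′ = cong (ι ∷_) (ιs-+ k k′)

relabel-ιs-+ : ∀ {k k′ l l′} {P Q : Term Sig} →
         P —[ ιs k ++ ιs k′ ∣ ιs l ++ ιs l′ ]→ Q → P —[ ιs (k + k′) ∣ ιs (l + l′) ]→ Q
relabel-ιs-+ {k = k} {k′} {l} {l′} =
  subst₂ (λ a b → _ —[ a ∣ b ]→ _) (ιs-+ k k′) (ιs-+ l l′)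

-- There is no clause for `μ`: a recursive term is related only through `base` or `same`, so `Rec`
-- never has to be analysed. `same` serves the operand left unchanged, as `S` need not be reflexive.
data Cong {Sig : Set} (S : Term Sig → Term Sig → Set) : Term Sig → Term Sig → Set where
  base : ∀ {P Q} → S P Q → Cong S P Q
  same : ∀ {P} → Cong S P P
  _⨾_  : ∀ {P Q P′ Q′} → Cong S P Q → Cong S P′ Q′ → Cong S (P ⨾ P′) (Q ⨾ Q′)
  _⊗_  : ∀ {P Q P′ Q′} → Cong S P Q → Cong S P′ Q′ → Cong S (P ⊗ P′) (Q ⊗ Q′)
  _⊕_  : ∀ {P Q P′ Q′} → Cong S P Q → Cong S P′ Q′ → Cong S (P ⊕ P′) (Q ⊕ Q′)
  -- P and Q are closed, so instantiating the binders of the prefix leaves them alone.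
  pre  : ∀ {u v P Q τ τ′} → ⊢ P ∶ τ → ⊢ Q ∶ τ → ⊢ pre u v P ∶ τ′ → ⊢ pre u v Q ∶ τ′ →
         Cong S P Q → Cong S (pre u v P) (pre u v Q)

Cong-flip : ∀ {S : Term Sig → Term Sig → Set} {P Q} → Cong S P Q → Cong (flip S) Q P
Cong-flip (base s)          = base s
Cong-flip same              = same
Cong-flip (c ⨾ d)           = Cong-flip c ⨾ Cong-flip d
Cong-flip (c ⊗ d)           = Cong-flip c ⊗ Cong-flip d
Cong-flip (c ⊕ d)           = Cong-flip c ⊕ Cong-flip d
Cong-flip (pre p q pp pq c) = pre q p pq pp (Cong-flip c)

module _ {S : Term Sig → Term Sig → Set} (sim : Simulation S) where

  Cong-Refl : ∀ {P Q k l} → Cong S P Q → ⊢ P ∶ (k , l) →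
              ∃[ Q′ ] (Q —[ ιs k ∣ ιs l ]→ Q′) × Cong S P Q′
  Cong-Refl (base s) p =
    let _ , t , s′ = sim s (Refl p) in _ , t , base s′
  Cong-Refl same p = _ , Refl p , same
  Cong-Refl (c ⨾ d) (⊢⨾ p q) =
    let _ , t , c′ = Cong-Refl c p
        _ , u , d′ = Cong-Refl d q
    -- The middle sort fixes one word of `ι`'s, so the two answers agree on the label being cut.
    in _ , Cut t u , c′ ⨾ d′
  Cong-Refl (c ⊗ d) (⊢⊗ {k = k} {l} p q) =
    let _ , t , c′ = Cong-Refl c p
        _ , u , d′ = Cong-Refl d q
    in _ , relabel-ιs-+ {k = k} {l = l} (Ten t u) , c′ ⊗ d′
  Cong-Refl (c ⊕ d) (⊢⊕ p q) =
    let _ , t , c′ = Cong-Refl c p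
        _ , u , d′ = Cong-Refl d q
    in _ , +ι t u , c′ ⊕ d′
  -- The lengths of `u` and `v` determine the sort of a prefix, so the stored sorting of the
  -- right-hand term has exactly the sort `(k , l)` that `Refl` needs.
  Cong-Refl c@(pre _ _ (⊢pre refl refl _ _ _) q _) (⊢pre refl refl _ _ _) =
    _ , Refl q , c

  -- Induction on the transition, not on the relation: in `ιL` and `ιR` the second premise is
  -- answered from the pair reached by the first, which need not be smaller than `c`.
  Cong-simulation : Simulation (Cong S)
  Cong-simulation c (Refl p) = Cong-Refl c p
  Cong-simulation c (ιL t u) =
    let _ , t′ , c₁ = Cong-simulation c t
        _ , u′ , c₂ = Cong-simulation c₁ u
    in _ , ιL t′ u′ , c₂
  Cong-simulation c (ιR t u) =
    let _ , t′ , c₁ = Cong-simulation c t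
        _ , u′ , c₂ = Cong-simulation c₁ u
    in _ , ιR t′ u′ , c₂
  Cong-simulation (base s) t =
    let _ , t′ , s′ = sim s t in _ , t′ , base s′
  Cong-simulation same t = _ , t , same
  Cong-simulation (c ⨾ d) (Cut t u) =
    let _ , t′ , c′ = Cong-simulation c t
        _ , u′ , d′ = Cong-simulation d u
    in _ , Cut t′ u′ , c′ ⨾ d′
  Cong-simulation (c ⊗ d) (Ten t u) =
    let _ , t′ , c′ = Cong-simulation c t
        _ , u′ , d′ = Cong-simulation d u
    in _ , Ten t′ u′ , c′ ⊗ d′
  Cong-simulation (c ⊕ d) (+ι t u) =
    let _ , t′ , c′ = Cong-simulation c t
        _ , u′ , d′ = Cong-simulation d u
    in _ , +ι t′ u′ , c′ ⊕ d′
  -- The side condition concerns the labels alone, and the answer carries the same labels.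
  Cong-simulation (c ⊕ d) (+L ¬ι t) =
    let _ , t′ , c′ = Cong-simulation c t in _ , +L ¬ι t′ , c′
  Cong-simulation (c ⊕ d) (+R ¬ι t) =
    let _ , t′ , d′ = Cong-simulation d t in _ , +R ¬ι t′ , d′
  Cong-simulation (pre p q _ _ c) (Pref σ us vs) =
    _ , Pref σ us vs ,
    subst₂ (Cong S) (sym (inst-closed σ p)) (sym (inst-closed σ q)) c

Cong-∼ : ∀ {S : Term Sig → Term Sig → Set} {P Q τ} →
         Simulation S → Simulation (flip S) →
         ⊢ P ∶ τ → ⊢ Q ∶ τ → Cong S P Q → P ∼ Q
Cong-∼ {S = S} sim sim⁻¹ p q c =
  (_ , p , q) , Cong S , c , Cong-simulation sim ,
  -- The converse of `Cong S` is `Cong (flip S)`, so the backward half is the forward half for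
  -- `flip S`, with the answer turned back.
  λ d t → let _ , t′ , d′ = Cong-simulation sim⁻¹ (Cong-flip d) t
          in _ , t′ , Cong-flip d′

mainTheorem1 : ∀ {Sig : Set} {k l m n k′ l′ : ℕ} {P Q R S T : Term Sig} →
    ⊢ P ∶ (k , l) → ⊢ Q ∶ (k , l) → ⊢ R ∶ (m , n) → ⊢ S ∶ (l , l′) → ⊢ T ∶ (k′ , k) →
    P ∼ Q →
    ((P ⨾ S ∼ Q ⨾ S) × (T ⨾ P ∼ T ⨾ Q)) ×
    ((P ⊗ R ∼ Q ⊗ R) × (R ⊗ P ∼ R ⊗ Q)) ×
    (∀ (u v : List (Atom Sig)) → ⊢ pre u v P ∶ (k , l) → ⊢ pre u v Q ∶ (k , l) → pre u v P ∼ pre u v Q) ×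
    (⊢ R ∶ (k , l) → (P ⊕ R ∼ Q ⊕ R) × (R ⊕ P ∼ R ⊕ Q))
mainTheorem1 p q r s t (_ , _ , PQ , sim , sim⁻¹) =
  ( Cong-∼ sim sim⁻¹ (⊢⨾ p s) (⊢⨾ q s) (base PQ ⨾ same)
  , Cong-∼ sim sim⁻¹ (⊢⨾ t p) (⊢⨾ t q) (same ⨾ base PQ)) ,
  ( Cong-∼ sim sim⁻¹ (⊢⊗ p r) (⊢⊗ q r) (base PQ ⊗ same)
  , Cong-∼ sim sim⁻¹ (⊢⊗ r p) (⊢⊗ r q) (same ⊗ base PQ)) ,
  (λ u v pp pq → Cong-∼ sim sim⁻¹ pp pq (pre p q pp pq (base PQ))) ,
  (λ r′ → Cong-∼ sim sim⁻¹ (⊢⊕ p r′) (⊢⊕ q r′) (base PQ ⊕ same)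
        , Cong-∼ sim sim⁻¹ (⊢⊕ r′ p) (⊢⊕ r′ q) (same ⊕ base PQ))
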